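{- All refinements $P'=(\mathsf O',\mathsf R',\mathsf{TTP}')\in P_{AGS}$ are attack-free.
   Context: **Protocol model.** There are three (most general) processes: the originator $\mathsf O$, the recipient $\mathsf R$ and the trusted third party $\mathsf{TTP}$. Messages: $\mathsf O$ may send $m_1,m_3$ to $\mathsf R$ and $a_1^{\mathsf O}$ (abort request), $r_1^{\mathsf O}$ (resolve request) to $\mathsf{TTP}$; $\mathsf R$ may send $m_2,m_4$ to $\mathsf O$ and $r_1^{\mathsf R}$ (resolve request) to $\mathsf{TTP}$; $\mathsf{TTP}$ may send $a_2^{\mathsf O}$ (abort token) or $r_2^{\mathsf O}$ (replacement for $\mathsf R$'s signature) to $\mathsf O$, and $a_2^{\mathsf R}$ (abort token) or $r_2^{\mathsf R}$ (replacement for $\mathsf O$'s signature) to $\mathsf R$. Each process, when scheduled, chooses a move: the idle move $\iota$ or sending a message it is able to compose; the $\mathsf{TTP}$ also has the moves $[a_2^{\mathsf O},a_2^{\mathsf R}]$ and $[r_2^{\mathsf O},r_2^{\mathsf R}]$, each sending both listed messages (in some order). Composability: $\mathsf R$ can send $m_2$ only after receiving $m_1$; $\mathsf O$ can send $m_3$ only after receiving $m_2$; $\mathsf R$ can send $m_4$ only after receiving $m_3$; $\mathsf O$ can send $r_1^{\mathsf O}$ only after receiving $m_2$; $\mathsf R$ can send $r_1^{\mathsf R}$ only after receiving $m_1$; $\mathsf O$ can send $m_1$ and $a_1^{\mathsf O}$ from the start. The most general processes may choose any composable move at any state. The $\mathsf{TTP}$ is *reasonable*: it never sends a message unless it has received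 an abort or resolve request; it processes messages first-in-first-out; if the first request received is an abort request it eventually sends an abort token; if the first request received is a resolve request it eventually sends an agent signature. **Predicates** (Boolean variables, initially false, monotonic: once true they stay true). Set by $\mathsf O$: $M_1$, $M_3$, $\mathrm{ABR}^{\mathsf O}$, $\mathrm{RES}^{\mathsf O}$ on sending $m_1,m_3,a_1^{\mathsf O},r_1^{\mathsf O}$; $\mathrm{EOR}$ on receiving $m_2$ or $r_2^{\mathsf O}$; $\mathrm{Sig}_{\mathsf R}^{\mathsf R}$ on receiving $m_4$; $\mathrm{Sig}_{\mathsf R}^{\mathsf{TTP}}$ on receiving $r_2^{\mathsf O}$; $\mathrm{AB}_{\mathsf O}$ on receiving $a_2^{\mathsf O}$. Set by $\mathsf R$: $M_2,M_4,\mathrm{RES}^{\mathsf R}$ on sending $m_2,m_4,r_1^{\mathsf R}$; $\mathrm{EOO}$ on receiving $m_1$ or $r_2^{\mathsf R}$; $\mathrm{Sig}_{\mathsf O}^{\mathsf O}$ on receiving $m_3$; $\mathrm{Sig}_{\mathsf O}^{\mathsf{TTP}}$ on receiving $r_2^{\mathsf R}$; $\mathrm{AB}_{\mathsf R}$ on receiving $a_2^{\mathsf R}$. Set by $\mathsf{TTP}$: $\mathrm{ABR}$ on receiving $a_1^{\mathsf O}$; $\mathrm{RES}$ on receiving $r_1^{\mathsf O}$ or $r_1^{\mathsf R}$; $A_2^{\mathsf O},A_2^{\mathsf R},R_2^{\mathsf O},R_2^{\mathsf R}$ on sending $a_2^{\mathsf O},a_2^{\mathsf R},r_2^{\mathsf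 O},r_2^{\mathsf R}$. A state is a valuation of all these variables; each process sees only the variables it sets. **Refinement.** $P'\preceq P$ means that $P'$ has the same variables as $P$, and at every valuation of those variables a nonempty subset of the moves of $P$, with the same effect. **Traces.** Channels between $\mathsf O$ and $\mathsf R$ are unreliable (messages may never be delivered); channels between each agent and the $\mathsf{TTP}$ are resilient (every message is eventually delivered, without a fixed bound and possibly out of order). A scheduler assigns turns as a function of the history; it is fair if every process gets infinitely many turns. $[\![P_1\parallel P_2\parallel P_3\parallel\mathrm{Sc}]\!]$ is the set of infinite sequences of valuations, starting from the all-false valuation, generated by the processes under all fair schedulers and all allowed channel behaviours. A formula is identified with the set of traces satisfying it. **Objectives** (LTL; $\Box$ = always, $\Diamond$ = eventually): - $\varphi_{\mathsf O}=\Diamond M_1\wedge\Box\big[(\Diamond\mathrm{Sig}_{\mathsf R}^{\mathsf R}\vee(\Diamond\mathrm{Sig}_{\mathsf R}^{\mathsf{TTP}}\wedge\Box\neg\mathrm{AB}_{\mathsf O}))\vee(\Diamond\mathrm{AB}_{\mathsf O}\wedge\Box(\neg\mathrm{Sig}_{\mathsf O}^{\mathsf O}\wedge\neg\mathrm{Sig}_{\mathsf O}^{\mathsf{TTP}}))\big]$. - $\varphi_{\mathsf R}=\Box\big[\mathrm{EOO}\Rightarrow\big((\Diamond\mathrm{Sig}_{\mathsf O}^{\mathsf O}\vee(\Diamond\mathrm{Sig}_{\mathsf O}^{\mathsf{TTP}}\wedge\Box\neg\mathrm{AB}_{\mathsf R}))\vee(\Diamond\mathrm{AB}_{\mathsf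 R}\wedge\Box(\neg\mathrm{Sig}_{\mathsf R}^{\mathsf R}\wedge\neg\mathrm{Sig}_{\mathsf R}^{\mathsf{TTP}}))\big)\big]$. - $\varphi_{\mathsf{TTP}}$ is the conjunction of: $\Box((\mathrm{ABR}\vee\mathrm{RES})\Rightarrow(\Diamond\mathrm{AB}_{\mathsf O}\vee\Diamond\mathrm{AB}_{\mathsf R}\vee\Diamond\mathrm{Sig}_{\mathsf O}^{\mathsf{TTP}}\vee\Diamond\mathrm{Sig}_{\mathsf R}^{\mathsf{TTP}}))$; $\Box(\mathrm{Sig}_{\mathsf O}^{\mathsf{TTP}}\Rightarrow(\Diamond\mathrm{Sig}_{\mathsf R}^{\mathsf{TTP}}\wedge\Box(\neg\mathrm{AB}_{\mathsf O}\wedge\neg\mathrm{AB}_{\mathsf R})))$; $\Box(\mathrm{Sig}_{\mathsf R}^{\mathsf{TTP}}\Rightarrow(\Diamond\mathrm{Sig}_{\mathsf O}^{\mathsf{TTP}}\wedge\Box(\neg\mathrm{AB}_{\mathsf O}\wedge\neg\mathrm{AB}_{\mathsf R})))$; $\Box(\mathrm{AB}_{\mathsf O}\Rightarrow(\Diamond\mathrm{AB}_{\mathsf R}\wedge\Box(\neg\mathrm{Sig}_{\mathsf O}^{\mathsf{TTP}}\wedge\neg\mathrm{Sig}_{\mathsf R}^{\mathsf{TTP}})))$; $\Box(\mathrm{AB}_{\mathsf R}\Rightarrow(\Diamond\mathrm{AB}_{\mathsf O}\wedge\Box(\neg\mathrm{Sig}_{\mathsf O}^{\mathsf{TTP}}\wedge\neg\mathrm{Sig}_{\mathsf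 R}^{\mathsf{TTP}})))$. **$P_{AGS}$** is the set of triples $(\mathsf O',\mathsf R',\mathsf{TTP}')$ with $\mathsf O'\preceq\mathsf O$, $\mathsf R'\preceq\mathsf R$, $\mathsf{TTP}'\preceq\mathsf{TTP}$ such that (for all fair schedulers and channel behaviours) (1) $[\![\mathsf O'\parallel\mathsf R\parallel\mathsf{TTP}\parallel\mathrm{Sc}]\!]\subseteq(\varphi_{\mathsf R}\wedge\varphi_{\mathsf{TTP}})\Rightarrow\varphi_{\mathsf O}$; (2) $[\![\mathsf O\parallel\mathsf R'\parallel\mathsf{TTP}\parallel\mathrm{Sc}]\!]\subseteq(\varphi_{\mathsf O}\wedge\varphi_{\mathsf{TTP}})\Rightarrow\varphi_{\mathsf R}$; (3) $[\![\mathsf O\parallel\mathsf R\parallel\mathsf{TTP}'\parallel\mathrm{Sc}]\!]\subseteq(\varphi_{\mathsf O}\wedge\varphi_{\mathsf R})\Rightarrow\varphi_{\mathsf{TTP}}$; (4) $[\![\mathsf O'\parallel\mathsf R'\parallel\mathsf{TTP}'\parallel\mathrm{Sc}]\!]\subseteq\varphi_{\mathsf O}\wedge\varphi_{\mathsf R}\wedge\varphi_{\mathsf{TTP}}$. **Attacks.** Let $A=\{\mathsf O,\mathsf R,\mathsf{TTP}\}$ and $Y\subseteq A$. $P'$ has a $Y$-attack if, when the participants in $Y$ are the most general ones and those in $A\setminus Y$ follow their refinements in $P'$, some generated trace satisfies the objectives of all participants in $Y$ but violates the objective of at least one participant in $A\setminus Y$. $P'$ is attack-free if it has no $Y$-attack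 for any $Y\subseteq A$. -}

module Defs where

open import Data.Bool.Base using (Bool; true; false; if_then_else_; _∨_; T)
open import Data.List.Base using (List; []; _∷_; _++_; applyUpTo; filterᵇ; foldr; length)
open import Data.List.Membership.Propositional using () renaming (_∈_ to _∈ˡ_)
open import Data.List.Relation.Binary.Permutation.Propositional using (_↭_)
open import Data.List.Relation.Unary.All using (All)
open import Data.Nat.Base using (ℕ; suc; _≤_)
open import Data.Product.Base using (∃; _×_; _,_)
open import Data.Sum.Base using (_⊎_)
open import Data.Unit.Base using (⊤; tt)
open import Function.Base using (_∘_)
open import Level using (0ℓ)
open import Relation.Binary.PropositionalEquality using (_≡_; refl)
open import Relation.Nullary using (¬_)
open import Relation.Unary using (Pred; _∈_; _⊆_; Satisfiable)

infix  4 _≼_ _,_⊨_ _⊨_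
infix  9 ¬′_ □_ ◇_
infixr 7 _∧′_
infixr 6 _∨′_
infixr 5 _⇒′_

------------------------------------------------------------------------
-- Participants, messages, variables

data Party : Set where
  O R TTP : Party

data Msg : Set where
  m₁ m₂ m₃ m₄           : Msg
  a₁-O r₁-O r₁-R        : Msg
  a₂-O a₂-R r₂-O r₂-R   : Msg

sender : Msg → Party
sender m₁   = O
sender m₂   = R
sender m₃   = O
sender m₄   = R
sender a₁-O = O
sender r₁-O = O
sender r₁-R = R
sender a₂-O = TTP
sender a₂-R = TTP
sender r₂-O = TTP
sender r₂-R = TTP

recipient : Msg → Party
recipient m₁   = R
recipient m₂   = O
recipient m₃   = R
recipient m₄   = O
recipient a₁-O = TTP
recipient r₁-O = TTP
recipient r₁-R = TTP
recipient a₂-O = O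
recipient a₂-R = R
recipient r₂-O = O
recipient r₂-R = R

-- Sig-X-Y holds when the signature of X has been obtained from Y.

record ValO : Set where
  constructor mkO
  field
    M₁ M₃ ABR-O RES-O EOR Sig-R-R Sig-R-TTP AB-O : Bool
open ValO public

record ValR : Set where
  constructor mkR
  field
    M₂ M₄ RES-R EOO Sig-O-O Sig-O-TTP AB-R : Bool
open ValR public

record ValTTP : Set where
  constructor mkTTP
  field
    ABR RES A₂-O A₂-R R₂-O R₂-R : Bool
open ValTTP public

Val : Party → Set
Val O   = ValO
Val R   = ValR
Val TTP = ValTTP

record State : Set where
  constructor mkState
  field
    valO   : ValO
    valR   : ValR
    valTTP : ValTTP
open State public

local : ∀ p → State → Val p
local O   = valO
local R   = valR
local TTP = valTTP

updateAt : ∀ p → (Val p → Val p) → State → State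
updateAt O   f s = record s { valO   = f (valO s) }
updateAt R   f s = record s { valR   = f (valR s) }
updateAt TTP f s = record s { valTTP = f (valTTP s) }

allFalse : State
allFalse = mkState
  (mkO false false false false false false false false)
  (mkR false false false false false false false)
  (mkTTP false false false false false false)

onSend : (m : Msg) → Val (sender m) → Val (sender m)
onSend m₁   v = record v { M₁    = true }
onSend m₂   v = record v { M₂    = true }
onSend m₃   v = record v { M₃    = true }
onSend m₄   v = record v { M₄    = true }
onSend a₁-O v = record v { ABR-O = true }
onSend r₁-O v = record v { RES-O = true }
onSend r₁-R v = record v { RES-R = true }
onSend a₂-O v = record v { A₂-O  = true }
onSend a₂-R v = record v { A₂-R  = true }
onSend r₂-O v = record v { R₂-O  = true }
onSend r₂-R v = record v { R₂-R  = true }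

onReceive : (m : Msg) → Val (recipient m) → Val (recipient m)
onReceive m₁   v = record v { EOO     = true }
onReceive m₂   v = record v { EOR     = true }
onReceive m₃   v = record v { Sig-O-O = true }
onReceive m₄   v = record v { Sig-R-R = true }
onReceive a₁-O v = record v { ABR     = true }
onReceive r₁-O v = record v { RES     = true }
onReceive r₁-R v = record v { RES     = true }
onReceive a₂-O v = record v { AB-O    = true }
onReceive a₂-R v = record v { AB-R    = true }
onReceive r₂-O v = record v { EOR = true ; Sig-R-TTP = true }
onReceive r₂-R v = record v { EOO = true ; Sig-O-TTP = true }

------------------------------------------------------------------------
-- Processes and refinement

-- aa and rr are [a₂ᴼ,a₂ᴿ] and [r₂ᴼ,r₂ᴿ].
data Move (p : Party) : Set where
  ι     : Move p
  send  : (m : Msg) → sender m ≡ p → Move p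
  aa rr : p ≡ TTP → Move p

messages : ∀ {p} → Move p → List Msg
messages ι          = []
messages (send m _) = m ∷ []
messages (aa _)     = a₂-O ∷ a₂-R ∷ []
messages (rr _)     = r₂-O ∷ r₂-R ∷ []

record Process (p : Party) : Set₁ where
  field
    moves    : Val p → Pred (Move p) 0ℓ
    nonempty : ∀ v → Satisfiable (moves v)
open Process public

_≼_ : ∀ {p} → Process p → Process p → Set
P′ ≼ P = ∀ v → moves P′ v ⊆ moves P v

-- What the sender's own variables say about whether it can send a message.
-- EOO and EOR are also set by r₂-R and r₂-O, so they do not by themselves
-- guarantee that m₁, respectively m₂, has arrived; see `composable`.
enabled : (m : Msg) → Val (sender m) → Set
enabled m₁   v = ⊤
enabled m₂   v = T (EOO v)
enabled m₃   v = T (EOR v)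
enabled m₄   v = T (Sig-O-O v)
enabled a₁-O v = ⊤
enabled r₁-O v = T (EOR v)
enabled r₁-R v = T (EOO v)
enabled a₂-O v = T (ABR v ∨ RES v)
enabled a₂-R v = T (ABR v ∨ RES v)
enabled r₂-O v = T (ABR v ∨ RES v)
enabled r₂-R v = T (ABR v ∨ RES v)

allowed : ∀ {p} → Val p → Pred (Move p) 0ℓ
allowed v ι             = ⊤
allowed v (send m refl) = enabled m v
allowed v (aa refl)     = T (ABR v ∨ RES v)
allowed v (rr refl)     = T (ABR v ∨ RES v)

mostGeneral : ∀ p → Process p
mostGeneral p = record { moves = allowed ; nonempty = λ _ → ι , tt }

System : Set₁
System = ∀ p → Process p

_∥_∥_ : Process O → Process R → Process TTP → System
(P₁ ∥ P₂ ∥ P₃) O   = P₁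
(P₁ ∥ P₂ ∥ P₃) R   = P₂
(P₁ ∥ P₂ ∥ P₃) TTP = P₃

------------------------------------------------------------------------
-- Temporal logic

Trace : Set
Trace = ℕ → State

data LTL : Set where
  atom             : (State → Bool) → LTL
  ¬′_ □_ ◇_        : LTL → LTL
  _∧′_ _∨′_ _⇒′_   : LTL → LTL → LTL

_,_⊨_ : Trace → ℕ → LTL → Set
σ , i ⊨ atom a   = T (a (σ i))
σ , i ⊨ ¬′ φ     = ¬ (σ , i ⊨ φ)
σ , i ⊨ □ φ      = ∀ j → i ≤ j → σ , j ⊨ φ
σ , i ⊨ ◇ φ      = ∃ λ j → i ≤ j × (σ , j ⊨ φ)
σ , i ⊨ φ ∧′ ψ   = (σ , i ⊨ φ) × (σ , i ⊨ ψ)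
σ , i ⊨ φ ∨′ ψ   = (σ , i ⊨ φ) ⊎ (σ , i ⊨ ψ)
σ , i ⊨ φ ⇒′ ψ   = (σ , i ⊨ φ) → (σ , i ⊨ ψ)

_⊨_ : Trace → LTL → Set
σ ⊨ φ = σ , 0 ⊨ φ

Sat : LTL → Pred Trace 0ℓ
Sat φ σ = σ ⊨ φ

O[_] : (ValO → Bool) → LTL
O[ x ] = atom (x ∘ valO)

R[_] : (ValR → Bool) → LTL
R[ x ] = atom (x ∘ valR)

TTP[_] : (ValTTP → Bool) → LTL
TTP[ x ] = atom (x ∘ valTTP)

φ-O : LTL
φ-O = ◇ O[ M₁ ]
   ∧′ □ ((◇ O[ Sig-R-R ] ∨′ (◇ O[ Sig-R-TTP ] ∧′ □ ¬′ O[ AB-O ]))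
         ∨′ (◇ O[ AB-O ] ∧′ □ (¬′ R[ Sig-O-O ] ∧′ ¬′ R[ Sig-O-TTP ])))

φ-R : LTL
φ-R = □ (R[ EOO ] ⇒′
         ((◇ R[ Sig-O-O ] ∨′ (◇ R[ Sig-O-TTP ] ∧′ □ ¬′ R[ AB-R ]))
          ∨′ (◇ R[ AB-R ] ∧′ □ (¬′ O[ Sig-R-R ] ∧′ ¬′ O[ Sig-R-TTP ]))))

φ-TTP : LTL
φ-TTP =
     □ ((TTP[ ABR ] ∨′ TTP[ RES ]) ⇒′
        (◇ O[ AB-O ] ∨′ ◇ R[ AB-R ] ∨′ ◇ R[ Sig-O-TTP ] ∨′ ◇ O[ Sig-R-TTP ]))
  ∧′ □ (R[ Sig-O-TTP ] ⇒′
        (◇ O[ Sig-R-TTP ] ∧′ □ (¬′ O[ AB-O ] ∧′ ¬′ R[ AB-R ])))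
  ∧′ □ (O[ Sig-R-TTP ] ⇒′
        (◇ R[ Sig-O-TTP ] ∧′ □ (¬′ O[ AB-O ] ∧′ ¬′ R[ AB-R ])))
  ∧′ □ (O[ AB-O ] ⇒′
        (◇ R[ AB-R ] ∧′ □ (¬′ R[ Sig-O-TTP ] ∧′ ¬′ O[ Sig-R-TTP ])))
  ∧′ □ (R[ AB-R ] ⇒′
        (◇ O[ AB-O ] ∧′ □ (¬′ R[ Sig-O-TTP ] ∧′ ¬′ O[ Sig-R-TTP ])))

objective : Party → LTL
objective O   = φ-O
objective R   = φ-R
objective TTP = φ-TTP

-- The liveness part of a reasonable TTP.  The TTP receives at most one
-- request per turn (see `Turn`), so a state with ABR and without RES occurs
-- exactly when the first request received is an abort request.
reasonable : LTL
reasonable =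
     □ ((TTP[ ABR ] ∧′ ¬′ TTP[ RES ]) ⇒′ ◇ (TTP[ A₂-O ] ∨′ TTP[ A₂-R ]))
  ∧′ □ ((TTP[ RES ] ∧′ ¬′ TTP[ ABR ]) ⇒′ ◇ (TTP[ R₂-O ] ∨′ TTP[ R₂-R ]))

------------------------------------------------------------------------
-- Runs

-- The valuation together with what is physically present but not recorded
-- in any variable: the messages sent and not yet received, and whether m₁
-- and m₂ have been received.
record Config : Set where
  constructor mkConfig
  field
    state         : State
    inTransit     : List Msg
    got-m₁ got-m₂ : Bool
open Config public

initial : Config
initial = mkConfig allFalse [] false false

composable : Config → Msg → Bool
composable c m₂   = got-m₁ c
composable c m₃   = got-m₂ c
composable c m₄   = Sig-O-O (valR (state c))
composable c r₁-O = got-m₂ c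
composable c r₁-R = got-m₁ c
composable c _    = true

note : Msg → Config → Config
note m₁ c = record c { got-m₁ = true }
note m₂ c = record c { got-m₂ = true }
note _  c = c

receive : Msg → Config → Config
receive m c =
  note m (record c { state = updateAt (recipient m) (onReceive m) (state c) })

emit : Msg → Config → Config
emit m c = record c
  { state     = updateAt (sender m) (onSend m) (state c)
  ; inTransit = m ∷ inTransit c }

-- A message that cannot be composed is not sent.  For the most general
-- processes such a choice is the same as ι; the clause only keeps a
-- refinement from getting stuck when EOO or EOR holds without m₁ or m₂.
perform : ∀ {p} → Move p → Config → Config
perform μ c = foldr emit c (filterᵇ (composable c) (messages μ))

-- Turn P c rs c′: the process P takes a turn from c to c′, in which the
-- channels first hand over the messages rs and P then moves.  Channel delays
-- are arbitrary, so a queue in front of the TTP is part of its channels; the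
-- TTP takes one request per turn, and can thus answer each request before it
-- sees the next.
data Turn {p : Party} (P : Process p) (c : Config) (rs : List Msg) : Config → Set where
  turn : (rest : List Msg) (μ : Move p) →
         inTransit c ↭ rs ++ rest →
         All (λ m → recipient m ≡ p) rs →
         (p ≡ TTP → length rs ≤ 1) →
         let d = foldr receive (record c { inTransit = rest }) rs in
         μ ∈ moves P (local p (state d)) →
         Turn P c rs (perform μ d)

Scheduler : Set
Scheduler = List State → Party

history : Trace → ℕ → List State
history σ j = applyUpTo σ (suc j)

Fair : Scheduler → Set
Fair Sc = ∀ (σ : Trace) p i → ∃ λ j → i ≤ j × Sc (history σ j) ≡ p

Resilient : Pred Msg 0ℓ
Resilient m = sender m ≡ TTP ⊎ recipient m ≡ TTP

record Run (𝒫 : System) (Sc : Scheduler) (σ : Trace) : Set where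
  field
    config     : ℕ → Config
    handedOver : ℕ → List Msg
    starts     : config 0 ≡ initial
    shows      : ∀ j → σ j ≡ state (config j)
    steps      : ∀ j → Turn (𝒫 (Sc (history σ j))) (config j) (handedOver j) (config (suc j))
    delivers   : ∀ i m → Resilient m → m ∈ˡ inTransit (config i) →
                 ∃ λ j → i ≤ j × m ∈ˡ handedOver j
    responds   : σ ⊨ reasonable

⟦_⟧ : System → Pred Trace 0ℓ
⟦ 𝒫 ⟧ σ = ∃ λ Sc → Fair Sc × Run 𝒫 Sc σ

------------------------------------------------------------------------
-- Assume-guarantee synthesis and attacks

record P-AGS (P′ : System) : Set where
  field
    refines : ∀ p → P′ p ≼ mostGeneral p
    cond₁   : ⟦ P′ O ∥ mostGeneral R ∥ mostGeneral TTP ⟧ ⊆ Sat ((φ-R ∧′ φ-TTP) ⇒′ φ-O)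
    cond₂   : ⟦ mostGeneral O ∥ P′ R ∥ mostGeneral TTP ⟧ ⊆ Sat ((φ-O ∧′ φ-TTP) ⇒′ φ-R)
    cond₃   : ⟦ mostGeneral O ∥ mostGeneral R ∥ P′ TTP ⟧ ⊆ Sat ((φ-O ∧′ φ-R) ⇒′ φ-TTP)
    cond₄   : ⟦ P′ O ∥ P′ R ∥ P′ TTP ⟧ ⊆ Sat (φ-O ∧′ φ-R ∧′ φ-TTP)

PartySet : Set
PartySet = Party → Bool

corrupt : PartySet → System → System
corrupt Y P′ p = if Y p then mostGeneral p else P′ p

HasAttack : PartySet → System → Set
HasAttack Y P′ = ∃ λ σ →
    σ ∈ ⟦ corrupt Y P′ ⟧
  × (∀ p → T (Y p) → σ ⊨ objective p)
  × (∃ λ p → ¬ T (Y p) × ¬ (σ ⊨ objective p))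

AttackFree : System → Set
AttackFree P′ = ∀ Y → ¬ HasAttack Y P′

{-# OPTIONS --safe #-}

-- A trusted third party meeting cond₃ keeps φ-TTP in every environment: let the
-- most general O and R first exchange m₁, …, m₄ and then replay the given run.
-- Both signatures have been handed over, so φ-O and φ-R hold whatever follows,
-- and φ-TTP mentions no variable that the exchange touches.  With φ-TTP
-- available, cond₁ and cond₂ settle every coalition that contains O or R.  If O
-- and R are both honest, either no request ever reaches the TTP, so that the TTP
-- stays idle and cond₄ applies, or φ-TTP makes both parties reach the same
-- outcome, which gives φ-R and then, by cond₁, φ-O.

module Submission where

open import Data.Bool.Base using (Bool; true; false; T)
open import Data.Bool.Properties using (T?; T-∨)
open import Data.Empty using (⊥-elim)
open import Data.List.Base using (List; []; _∷_; _++_; filterᵇ; foldr; length; map)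
open import Data.List.Membership.Propositional using () renaming (_∈_ to _∈ˡ_; _∉_ to _∉ˡ_)
open import Data.List.Membership.Propositional.Properties using (∈-++⁺ˡ; ∈-++⁺ʳ)
open import Data.List.Properties using (foldr-fusion; length-applyUpTo)
open import Data.List.Relation.Binary.Permutation.Propositional using (_↭_; ↭-refl; ↭-sym)
open import Data.List.Relation.Binary.Permutation.Propositional.Properties using (∈-resp-↭)
open import Data.List.Relation.Unary.All as All using (All; []; _∷_)
open import Data.List.Relation.Unary.All.Properties using (¬Any⇒All¬; all-filter)
open import Data.List.Relation.Unary.Any using (here; there)
open import Data.Nat.Base using (ℕ; zero; suc; pred; _+_; _≤_; _≤′_; ≤′-refl; ≤′-step; z≤n; s≤s)
open import Data.Nat.Properties using (≤-total; ≤-trans; ≤⇒≤′; m≤n+m; m≤m+n)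
open import Data.Product.Base using (∃; _×_; _,_; proj₁; proj₂)
open import Data.Sum.Base as Sum using (_⊎_; inj₁; inj₂; [_,_]′)
open import Data.Unit.Base using (tt)
open import Function.Base using (_∘_; id)
open import Function.Bundles using (module Equivalence)
open import Relation.Binary.PropositionalEquality
  using (_≡_; _≢_; refl; sym; trans; cong; subst)
open import Relation.Nullary using (¬_; Dec; yes; no; contradiction)
open import Relation.Nullary.Decidable using (¬¬-excluded-middle)
open import Relation.Unary using (_∈_; _⊆_)

open import Defs

open Run

-- Temporal logic

mutual
  -- Negation and the premise of an implication swap the two directions, hence the mutual induction
  -- on the formula.
  ⊨-tail⁻ : ∀ φ {τ i} → τ , suc i ⊨ φ → (τ ∘ suc) , i ⊨ φ
  ⊨-tail⁻ (atom _) a             = a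
  ⊨-tail⁻ (¬′ φ)   ¬a            = ¬a ∘ ⊨-tail⁺ φ
  ⊨-tail⁻ (□ φ)    a j i≤j       = ⊨-tail⁻ φ (a (suc j) (s≤s i≤j))
  ⊨-tail⁻ (◇ φ) (suc j , s≤s i≤j , a) = j , i≤j , ⊨-tail⁻ φ a
  ⊨-tail⁻ (φ ∧′ ψ) (a , b)       = ⊨-tail⁻ φ a , ⊨-tail⁻ ψ b
  ⊨-tail⁻ (φ ∨′ ψ) (inj₁ a)      = inj₁ (⊨-tail⁻ φ a)
  ⊨-tail⁻ (φ ∨′ ψ) (inj₂ b)      = inj₂ (⊨-tail⁻ ψ b)
  ⊨-tail⁻ (φ ⇒′ ψ) f             = ⊨-tail⁻ ψ ∘ f ∘ ⊨-tail⁺ φ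

  ⊨-tail⁺ : ∀ φ {τ i} → (τ ∘ suc) , i ⊨ φ → τ , suc i ⊨ φ
  ⊨-tail⁺ (atom _) a                  = a
  ⊨-tail⁺ (¬′ φ)   ¬a                 = ¬a ∘ ⊨-tail⁻ φ
  ⊨-tail⁺ (□ φ)    a (suc j) (s≤s i≤j) = ⊨-tail⁺ φ (a j i≤j)
  ⊨-tail⁺ (◇ φ) (j , i≤j , a)         = suc j , s≤s i≤j , ⊨-tail⁺ φ a
  ⊨-tail⁺ (φ ∧′ ψ) (a , b)            = ⊨-tail⁺ φ a , ⊨-tail⁺ ψ b
  ⊨-tail⁺ (φ ∨′ ψ) (inj₁ a)           = inj₁ (⊨-tail⁺ φ a)
  ⊨-tail⁺ (φ ∨′ ψ) (inj₂ b)           = inj₂ (⊨-tail⁺ ψ b)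
  ⊨-tail⁺ (φ ⇒′ ψ) f                  = ⊨-tail⁺ ψ ∘ f ∘ ⊨-tail⁻ φ

⊨-drop⁻ : ∀ φ k {τ} → τ , k ⊨ φ → (λ n → τ (k + n)) ⊨ φ
⊨-drop⁻ φ zero    a = a
⊨-drop⁻ φ (suc k) a = ⊨-drop⁻ φ k (⊨-tail⁻ φ a)

⊨-drop⁺ : ∀ φ k {τ} → (λ n → τ (k + n)) ⊨ φ → τ , k ⊨ φ
⊨-drop⁺ φ zero    a = a
⊨-drop⁺ φ (suc k) a = ⊨-tail⁺ φ (⊨-drop⁺ φ k a)

-- Runs

Run-map : ∀ {𝒫 𝒬 : System} {Sc σ} (r : Run 𝒫 Sc σ) →
          (∀ j p → Turn (𝒫 p) (config r j) (handedOver r j) (config r (suc j)) →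
                   Turn (𝒬 p) (config r j) (handedOver r j) (config r (suc j))) →
          Run 𝒬 Sc σ
Run-map {Sc = Sc} {σ} r f = record
  { Run r hiding (steps) ; steps = λ j → f j (Sc (history σ j)) (steps r j) }

⟦⟧-mono : ∀ {𝒫 𝒬 : System} → (∀ p → 𝒫 p ≼ 𝒬 p) → ⟦ 𝒫 ⟧ ⊆ ⟦ 𝒬 ⟧
⟦⟧-mono {𝒫} {𝒬} 𝒫≼𝒬 (Sc , fair , r) = Sc , fair , Run-map r (λ _ p → widen p)
  where
  widen : ∀ p {c rs c′} → Turn (𝒫 p) c rs c′ → Turn (𝒬 p) c rs c′
  widen p (turn rest μ perm to one μ∈) = turn rest μ perm to one (𝒫≼𝒬 p _ μ∈)

-- A history at time `j` has `suc j` entries, so its length tells the time: any fixed sequence of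
-- turns is realised by a scheduler, whatever the trace.
clocked : (ℕ → Party) → Scheduler
clocked κ h = κ (pred (length h))

clocked-history : ∀ κ τ j → clocked κ (history τ j) ≡ κ j
clocked-history κ τ j = cong (κ ∘ pred) (length-applyUpTo τ (suc j))

prepend : ∀ {A : Set} → List A → (ℕ → A) → ℕ → A
prepend []       f         = f
prepend (x ∷ xs) f zero    = x
prepend (x ∷ xs) f (suc n) = prepend xs f n

foldr-invariant : ∀ {Q : Msg → Set} (I : Config → Set) {f : Msg → Config → Config} →
                  (∀ m c → Q m → I c → I (f m c)) →
                  ∀ {c ms} → All Q ms → I c → I (foldr f c ms)
foldr-invariant I step []       i = i
foldr-invariant I step (q ∷ qs) i = step _ _ q (foldr-invariant I step qs i)

-- The constructor `turn` computes its final configuration; the equations admit configurations that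
-- are only propositionally equal to it.
turn-to : ∀ {p} {P : Process p} {c rs d c′} rest (μ : Move p) →
          inTransit c ↭ rs ++ rest →
          All (λ m → recipient m ≡ p) rs →
          (p ≡ TTP → length rs ≤ 1) →
          d ≡ foldr receive (record c { inTransit = rest }) rs →
          μ ∈ moves P (local p (state d)) →
          perform μ d ≡ c′ →
          Turn P c rs c′
turn-to rest μ perm to one refl μ∈ refl = turn rest μ perm to one μ∈

-- The exchange of m₁, …, m₄

exchange : State → State
exchange s = record
  { valO   = record (valO s) { M₁ = true ; M₃ = true ; EOR = true ; Sig-R-R = true }
  ; valR   = record (valR s) { M₂ = true ; M₄ = true ; EOO = true ; Sig-O-O = true }
  ; valTTP = valTTP s
  }

exchanged : Config → Config
exchanged c = record c { state = exchange (state c) ; got-m₁ = true ; got-m₂ = true }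

-- Both operations do nothing but set flags to true, so their order is immaterial.
receive-exchanged : ∀ m c → exchanged (receive m c) ≡ receive m (exchanged c)
receive-exchanged m₁   _ = refl
receive-exchanged m₂   _ = refl
receive-exchanged m₃   _ = refl
receive-exchanged m₄   _ = refl
receive-exchanged a₁-O _ = refl
receive-exchanged r₁-O _ = refl
receive-exchanged r₁-R _ = refl
receive-exchanged a₂-O _ = refl
receive-exchanged a₂-R _ = refl
receive-exchanged r₂-O _ = refl
receive-exchanged r₂-R _ = refl

module _ (P : Process TTP) where

  private
    𝒫 : System
    𝒫 = mostGeneral O ∥ mostGeneral R ∥ P

  -- O and R may hold more after the exchange, so a message that could not be
  -- composed in the given run must be replaced by ι.
  replay : ∀ p (μ : Move p) d → μ ∈ moves (𝒫 p) (local p (state d)) →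
           ∃ λ μ′ → μ′ ∈ moves (𝒫 p) (local p (exchange (state d))) ×
                    perform μ′ (exchanged d) ≡ exchanged (perform μ d)
  replay O ι                d _ = ι , tt , refl
  replay O (send m₁ refl)   d _ = send m₁ refl , tt , refl
  replay O (send m₃ refl)   d _ with got-m₂ d
  ... | true                    = send m₃ refl , tt , refl
  ... | false                   = ι , tt , refl
  replay O (send a₁-O refl) d _ = send a₁-O refl , tt , refl
  replay O (send r₁-O refl) d _ with got-m₂ d
  ... | true                    = send r₁-O refl , tt , refl
  ... | false                   = ι , tt , refl
  replay R ι                d _ = ι , tt , refl
  replay R (send m₂ refl)   d _ with got-m₁ d
  ... | true                    = send m₂ refl , tt , refl
  ... | false                   = ι , tt , refl
  replay R (send m₄ refl)   d _ with Sig-O-O (valR (state d))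
  ... | true                    = send m₄ refl , tt , refl
  ... | false                   = ι , tt , refl
  replay R (send r₁-R refl) d _ with got-m₁ d
  ... | true                    = send r₁-R refl , tt , refl
  ... | false                   = ι , tt , refl
  -- The exchange leaves the valuation of the TTP alone, so `P` still offers the same move.
  replay TTP ι                d μ∈ = ι , μ∈ , refl
  replay TTP (send a₂-O refl) d μ∈ = send a₂-O refl , μ∈ , refl
  replay TTP (send a₂-R refl) d μ∈ = send a₂-R refl , μ∈ , refl
  replay TTP (send r₂-O refl) d μ∈ = send r₂-O refl , μ∈ , refl
  replay TTP (send r₂-R refl) d μ∈ = send r₂-R refl , μ∈ , refl
  replay TTP (aa refl)        d μ∈ = aa refl , μ∈ , refl
  replay TTP (rr refl)        d μ∈ = rr refl , μ∈ , refl

  turn-exchanged : ∀ p {c rs c′} → Turn (𝒫 p) c rs c′ →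
                   Turn (𝒫 p) (exchanged c) rs (exchanged c′)
  turn-exchanged p {c} {rs} (turn rest μ perm to one μ∈) =
    let d              = record c { inTransit = rest }
        μ′ , μ′∈ , eq = replay p μ (foldr receive d rs) μ∈
    in turn-to rest μ′ perm to one (foldr-fusion exchanged d receive-exchanged rs) μ′∈ eq

  module _ {Sc σ} (fair : Fair Sc) (r : Run 𝒫 Sc σ) where

    preamble : List Config
    preamble = c₀ ∷ c₁ ∷ c₂ ∷ c₃ ∷ c₄ ∷ []
      where
      c₀ = initial
      c₁ = emit m₁ c₀
      c₂ = emit m₂ (receive m₁ (record c₁ { inTransit = [] }))
      c₃ = emit m₃ (receive m₂ (record c₂ { inTransit = [] }))
      c₄ = emit m₄ (receive m₃ (record c₃ { inTransit = [] }))

    -- The fifth turn lets `O` receive `m₄`. Afterwards the turns are those that `Sc` chose along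
    -- `σ`; consulting `Sc` on the longer history could change them.
    κ : ℕ → Party
    κ = prepend (O ∷ R ∷ O ∷ R ∷ O ∷ []) (λ j → Sc (history σ j))

    τ : Trace
    τ = prepend (map state preamble) (exchange ∘ σ)

    config⁺ : ℕ → Config
    config⁺ = prepend preamble (exchanged ∘ config r)

    handedOver⁺ : ℕ → List Msg
    handedOver⁺ = prepend ([] ∷ (m₁ ∷ []) ∷ (m₂ ∷ []) ∷ (m₃ ∷ []) ∷ (m₄ ∷ []) ∷ [])
                          (handedOver r)

    shows⁺ : ∀ j → τ j ≡ state (config⁺ j)
    shows⁺ 0 = refl
    shows⁺ 1 = refl
    shows⁺ 2 = refl
    shows⁺ 3 = refl
    shows⁺ 4 = refl
    shows⁺ (suc (suc (suc (suc (suc j))))) = cong exchange (shows r j)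

    steps⁺ : ∀ j → Turn (𝒫 (κ j)) (config⁺ j) (handedOver⁺ j) (config⁺ (suc j))
    steps⁺ 0 = turn [] (send m₁ refl) ↭-refl [] (λ ()) tt
    steps⁺ 1 = turn [] (send m₂ refl) ↭-refl (refl ∷ []) (λ ()) tt
    steps⁺ 2 = turn [] (send m₃ refl) ↭-refl (refl ∷ []) (λ ()) tt
    steps⁺ 3 = turn [] (send m₄ refl) ↭-refl (refl ∷ []) (λ ()) tt
    -- Receiving `m₄` and idling leads to `exchanged initial`, which `starts r` identifies with the
    -- first replayed configuration.
    steps⁺ 4 rewrite starts r = turn [] ι ↭-refl (refl ∷ []) (λ ()) tt
    steps⁺ (suc (suc (suc (suc (suc j))))) = turn-exchanged _ (steps r j)

    delivers⁺ : ∀ i m → Resilient m → m ∈ˡ inTransit (config⁺ i) →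
                ∃ λ j → i ≤ j × m ∈ˡ handedOver⁺ j
    delivers⁺ 0 _ _ ()
    -- Until the replay starts, only `m₁`, ..., `m₄` are ever in transit, and their channels are not
    -- resilient.
    delivers⁺ 1 _ (inj₁ ()) (here refl)
    delivers⁺ 1 _ (inj₂ ()) (here refl)
    delivers⁺ 2 _ (inj₁ ()) (here refl)
    delivers⁺ 2 _ (inj₂ ()) (here refl)
    delivers⁺ 3 _ (inj₁ ()) (here refl)
    delivers⁺ 3 _ (inj₂ ()) (here refl)
    delivers⁺ 4 _ (inj₁ ()) (here refl)
    delivers⁺ 4 _ (inj₂ ()) (here refl)
    delivers⁺ (suc (suc (suc (suc (suc i))))) m res m∈
      with j , i≤j , m∈j ← delivers r i m res m∈
      = 5 + j , s≤s (s≤s (s≤s (s≤s (s≤s i≤j)))) , m∈j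

    -- exchange leaves the variables of the formulas reasonable and φ-TTP alone,
    -- so they mean definitionally the same on σ and on exchange ∘ σ.
    responds⁺ : τ ⊨ reasonable
    responds⁺ =
        (λ j _ → [ (λ eq a → ⊥-elim (subst (T ∘ ABR) eq (proj₁ a))) , proj₁ late j ]′ (blank j))
      , (λ j _ → [ (λ eq a → ⊥-elim (subst (T ∘ RES) eq (proj₁ a))) , proj₂ late j ]′ (blank j))
      where
      late : τ , 5 ⊨ reasonable
      late = ⊨-drop⁺ reasonable 5 {τ} (responds r)

      -- No request occurs during the exchange, so the premises in `reasonable` fail there.
      blank : ∀ j → valTTP (τ j) ≡ valTTP allFalse ⊎ 5 ≤ j
      blank 0 = inj₁ refl
      blank 1 = inj₁ refl
      blank 2 = inj₁ refl
      blank 3 = inj₁ refl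
      blank 4 = inj₁ refl
      blank (suc (suc (suc (suc (suc j))))) = inj₂ (m≤m+n 5 j)

    scheduler⁺ : Scheduler
    scheduler⁺ = clocked κ

    -- `scheduler⁺` looks only at the length of the history, so fairness of `Sc` along `σ` yields
    -- fairness along every `ρ`.
    fair⁺ : Fair scheduler⁺
    fair⁺ ρ p i with j , i≤j , eq ← fair σ p i =
      5 + j , ≤-trans i≤j (m≤n+m j 5) , trans (clocked-history κ ρ (5 + j)) eq

    run⁺ : Run 𝒫 scheduler⁺ τ
    run⁺ = record
      { config     = config⁺
      ; handedOver = handedOver⁺
      ; starts     = refl
      ; shows      = shows⁺
      ; steps      = λ j → subst (λ p → Turn (𝒫 p) (config⁺ j) (handedOver⁺ j) (config⁺ (suc j)))
                                 (sym (clocked-history κ τ j)) (steps⁺ j)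
      ; delivers   = delivers⁺
      ; responds   = responds⁺
      }

    exchange⊨φ-O : τ ⊨ φ-O
    -- State 1 follows the sending of `m₁`; state `5 + j` is no earlier than `j` and lies after the
    -- exchange, so `Sig-R-R` holds in it.
    exchange⊨φ-O = (1 , z≤n , tt) , λ j _ → inj₁ (inj₁ (5 + j , m≤n+m j 5 , tt))

    exchange⊨φ-R : τ ⊨ φ-R
    exchange⊨φ-R j _ _ = inj₁ (inj₁ (5 + j , m≤n+m j 5 , tt))

    φ-TTP-after-exchange : τ ⊨ φ-TTP → σ ⊨ φ-TTP
    φ-TTP-after-exchange (a , b , c , d , e) =
      -- Each conjunct is an invariant, so it holds from state 5 onwards; shifting by 5 removes the
      -- preamble.
      ⊨-drop⁻ φ-TTP 5 {τ} (later a , later b , later c , later d , later e)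
      where
      later : ∀ {A : ℕ → Set} → (∀ j → 0 ≤ j → A j) → ∀ j → 5 ≤ j → A j
      later f j _ = f j z≤n

  φ-TTP-unconditional : ⟦ 𝒫 ⟧ ⊆ Sat ((φ-O ∧′ φ-R) ⇒′ φ-TTP) → ⟦ 𝒫 ⟧ ⊆ Sat φ-TTP
  φ-TTP-unconditional cond (Sc , fair , r) =
    φ-TTP-after-exchange fair r
      (cond (scheduler⁺ fair r , fair⁺ fair r , run⁺ fair r) (exchange⊨φ-O fair r , exchange⊨φ-R fair r))

-- Persistence

Requested : State → Set
Requested s = T (ABR (valTTP s)) ⊎ T (RES (valTTP s))

-- `φ-R` demands its eventualities at later instants too, so the variables of `R` in them must stay
-- true once set. The last two entries keep requests visible.
latches : List (State → Bool)
latches = Sig-O-O ∘ valR ∷ Sig-O-TTP ∘ valR ∷ AB-R ∘ valR ∷ ABR ∘ valTTP ∷ RES ∘ valTTP ∷ []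

infix 4 _⊑_
_⊑_ : State → State → Set
s ⊑ t = All (λ x → T (x s) → T (x t)) latches

⊑-refl : ∀ {s} → s ⊑ s
⊑-refl = id ∷ id ∷ id ∷ id ∷ id ∷ []

⊑-trans : ∀ {s t u} → s ⊑ t → t ⊑ u → s ⊑ u
⊑-trans s⊑t t⊑u = All.zipWith (λ (f , g) → g ∘ f) (s⊑t , t⊑u)

receive-⊑ : ∀ m c → state c ⊑ state (receive m c)
receive-⊑ m₁   c = id ∷ id ∷ id ∷ id ∷ id ∷ []
receive-⊑ m₂   c = id ∷ id ∷ id ∷ id ∷ id ∷ []
-- Where the message sets the latch, the target is `⊤`, and `_` is solved by η.
receive-⊑ m₃   c = _  ∷ id ∷ id ∷ id ∷ id ∷ []
receive-⊑ m₄   c = id ∷ id ∷ id ∷ id ∷ id ∷ []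
receive-⊑ a₁-O c = id ∷ id ∷ id ∷ _  ∷ id ∷ []
receive-⊑ r₁-O c = id ∷ id ∷ id ∷ id ∷ _  ∷ []
receive-⊑ r₁-R c = id ∷ id ∷ id ∷ id ∷ _  ∷ []
receive-⊑ a₂-O c = id ∷ id ∷ id ∷ id ∷ id ∷ []
receive-⊑ a₂-R c = id ∷ id ∷ _  ∷ id ∷ id ∷ []
receive-⊑ r₂-O c = id ∷ id ∷ id ∷ id ∷ id ∷ []
receive-⊑ r₂-R c = id ∷ _  ∷ id ∷ id ∷ id ∷ []

emit-⊑ : ∀ m c → state c ⊑ state (emit m c)
emit-⊑ m₁   c = id ∷ id ∷ id ∷ id ∷ id ∷ []
emit-⊑ m₂   c = id ∷ id ∷ id ∷ id ∷ id ∷ []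
emit-⊑ m₃   c = id ∷ id ∷ id ∷ id ∷ id ∷ []
emit-⊑ m₄   c = id ∷ id ∷ id ∷ id ∷ id ∷ []
emit-⊑ a₁-O c = id ∷ id ∷ id ∷ id ∷ id ∷ []
emit-⊑ r₁-O c = id ∷ id ∷ id ∷ id ∷ id ∷ []
emit-⊑ r₁-R c = id ∷ id ∷ id ∷ id ∷ id ∷ []
emit-⊑ a₂-O c = id ∷ id ∷ id ∷ id ∷ id ∷ []
emit-⊑ a₂-R c = id ∷ id ∷ id ∷ id ∷ id ∷ []
emit-⊑ r₂-O c = id ∷ id ∷ id ∷ id ∷ id ∷ []
emit-⊑ r₂-R c = id ∷ id ∷ id ∷ id ∷ id ∷ []

foldr-⊑ : ∀ {f : Msg → Config → Config} → (∀ m c → state c ⊑ state (f m c)) →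
          ∀ ms c → state c ⊑ state (foldr f c ms)
foldr-⊑ f-⊑ []       c = ⊑-refl
foldr-⊑ f-⊑ (m ∷ ms) c = ⊑-trans (foldr-⊑ f-⊑ ms c) (f-⊑ m _)

perform-⊑ : ∀ {p} (μ : Move p) c → state c ⊑ state (perform μ c)
perform-⊑ μ c = foldr-⊑ emit-⊑ (filterᵇ (composable c) (messages μ)) c

turn-⊑ : ∀ {p} {P : Process p} {c rs c′} → Turn P c rs c′ → state c ⊑ state c′
turn-⊑ {rs = rs} (turn rest μ _ _ _ _) = ⊑-trans (foldr-⊑ receive-⊑ rs _) (perform-⊑ μ _)

Requested-⊑ : ∀ {s t} → s ⊑ t → Requested s → Requested t
Requested-⊑ (_ ∷ _ ∷ _ ∷ abr ∷ res ∷ []) = Sum.map abr res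

-- Runs without a request

allowed-unrequested : ∀ {v} → ¬ (T (ABR v) ⊎ T (RES v)) → (μ : Move TTP) → allowed v μ → μ ≡ ι
allowed-unrequested ¬req ι                _ = refl
allowed-unrequested ¬req (send a₂-O refl) t = contradiction (Equivalence.to T-∨ t) ¬req
allowed-unrequested ¬req (send a₂-R refl) t = contradiction (Equivalence.to T-∨ t) ¬req
allowed-unrequested ¬req (send r₂-O refl) t = contradiction (Equivalence.to T-∨ t) ¬req
allowed-unrequested ¬req (send r₂-R refl) t = contradiction (Equivalence.to T-∨ t) ¬req
allowed-unrequested ¬req (aa refl)        t = contradiction (Equivalence.to T-∨ t) ¬req
allowed-unrequested ¬req (rr refl)        t = contradiction (Equivalence.to T-∨ t) ¬req

-- `μ` is forced to be `ι`, and so is the move that `nonempty` provides for `Q`: a request received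
-- in this turn would still show in `c′`.
turn-unrequested : ∀ {P Q : Process TTP} → P ≼ mostGeneral TTP → Q ≼ mostGeneral TTP →
                   ∀ {c rs c′} → ¬ Requested (state c′) → Turn P c rs c′ → Turn Q c rs c′
turn-unrequested {Q = Q} P≼ Q≼ {c} {rs} ¬req (turn rest μ perm to one μ∈)
  with d ← foldr receive (record c { inTransit = rest }) rs in d≡
  with ¬req-d ← ¬req ∘ Requested-⊑ (perform-⊑ μ d)
  with μ′ , μ′∈ ← nonempty Q (valTTP (state d))
  with refl ← allowed-unrequested ¬req-d μ (P≼ _ μ∈)
  with refl ← allowed-unrequested ¬req-d μ′ (Q≼ _ μ′∈)
  with refl ← d≡
  = turn rest ι perm to one μ′∈

-- This makes `cond₄`, which speaks of the honest TTP, available for runs with the most general one.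
Run-unrequested : ∀ {P₁ P₂} {P Q : Process TTP} → P ≼ mostGeneral TTP → Q ≼ mostGeneral TTP →
                  ∀ {Sc σ} → (∀ j → ¬ Requested (σ j)) →
                  Run (P₁ ∥ P₂ ∥ P) Sc σ → Run (P₁ ∥ P₂ ∥ Q) Sc σ
Run-unrequested P≼ Q≼ ¬req r = Run-map r λ where
  j O   t → t
  j R   t → t
  j TTP t → turn-unrequested P≼ Q≼ (¬req (suc j) ∘ subst Requested (sym (shows r (suc j)))) t

-- Runs with a request

-- m₄ can only be composed once Sig-O-O holds, so without Sig-O-O nothing sets Sig-R-R.
Unsigned : Config → Set
Unsigned c = m₄ ∉ˡ inTransit c × ¬ T (Sig-R-R (valO (state c)))

receive-Unsigned : ∀ m c → m₄ ≢ m → Unsigned c → Unsigned (receive m c)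
receive-Unsigned m₁   c _ u = u
receive-Unsigned m₂   c _ u = u
receive-Unsigned m₃   c _ u = u
receive-Unsigned m₄   c ≢ u = contradiction refl ≢
receive-Unsigned a₁-O c _ u = u
receive-Unsigned r₁-O c _ u = u
receive-Unsigned r₁-R c _ u = u
receive-Unsigned a₂-O c _ u = u
receive-Unsigned a₂-R c _ u = u
receive-Unsigned r₂-O c _ u = u
receive-Unsigned r₂-R c _ u = u

emit-Sig-R-R : ∀ m c → Sig-R-R (valO (state (emit m c))) ≡ Sig-R-R (valO (state c))
emit-Sig-R-R m₁   c = refl
emit-Sig-R-R m₂   c = refl
emit-Sig-R-R m₃   c = refl
emit-Sig-R-R m₄   c = refl
emit-Sig-R-R a₁-O c = refl
emit-Sig-R-R r₁-O c = refl
emit-Sig-R-R r₁-R c = refl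
emit-Sig-R-R a₂-O c = refl
emit-Sig-R-R a₂-R c = refl
emit-Sig-R-R r₂-O c = refl
emit-Sig-R-R r₂-R c = refl

emit-Unsigned : ∀ m c → m₄ ≢ m → Unsigned c → Unsigned (emit m c)
emit-Unsigned m c m₄≢m (∉ , ¬sig) =
  (λ { (here eq) → m₄≢m eq ; (there ∈) → ∉ ∈ }) , ¬sig ∘ subst T (emit-Sig-R-R m c)

turn-Unsigned : ∀ {p} {P : Process p} {c rs c′} → ¬ T (Sig-O-O (valR (state c′))) →
                Turn P c rs c′ → Unsigned c → Unsigned c′
turn-Unsigned {c = c} {rs} ¬sig (turn rest μ perm _ _ _) (∉ , ¬sig-R) =
  foldr-invariant Unsigned emit-Unsigned
    -- `m₄` passes the filter only if `Sig-O-O` holds in `d`, from where it would persist into `c′`,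
    -- against `¬sig`.
    (All.map (λ { comp refl → ¬sig (All.head (perform-⊑ μ d) comp) })
             (all-filter (T? ∘ composable d) (messages μ)))
    (foldr-invariant Unsigned receive-Unsigned
      (¬Any⇒All¬ rs (∉ ∘ ∈-resp-↭ (↭-sym perm) ∘ ∈-++⁺ˡ))
      (∉ ∘ ∈-resp-↭ (↭-sym perm) ∘ ∈-++⁺ʳ rs , ¬sig-R))
  where
  d = foldr receive (record c { inTransit = rest }) rs

module _ {𝒫 Sc σ} (r : Run 𝒫 Sc σ) where

  config-⊑ : ∀ {i j} → i ≤′ j → state (config r i) ⊑ state (config r j)
  config-⊑ ≤′-refl         = ⊑-refl
  config-⊑ (≤′-step i≤′j) = ⊑-trans (config-⊑ i≤′j) (turn-⊑ (steps r _))

  trace-⊑ : ∀ {i j} → i ≤ j → σ i ⊑ σ j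
  trace-⊑ {i} {j} i≤j rewrite shows r i | shows r j = config-⊑ (≤⇒≤′ i≤j)

  ¬Sig-O-O⇒¬Sig-R-R : (∀ j → ¬ T (Sig-O-O (valR (σ j)))) → ∀ j → ¬ T (Sig-R-R (valO (σ j)))
  ¬Sig-O-O⇒¬Sig-R-R ¬sig j rewrite shows r j = proj₂ (unsigned j)
    where
    unsigned : ∀ j → Unsigned (config r j)
    unsigned zero rewrite starts r = (λ ()) , λ ()
    unsigned (suc j) =
      turn-Unsigned (subst (λ s → ¬ T (Sig-O-O (valR s))) (shows r (suc j)) (¬sig (suc j)))
                    (steps r j) (unsigned j)

  ◇-latch : ∀ {x k} → x ∈ˡ latches → T (x (σ k)) → ∀ i → σ , i ⊨ ◇ (atom x)
  ◇-latch {k = k} x∈ t i =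
    -- `i + k` is no earlier than `i`, as `◇` requires, and no earlier than `k`, where the latch is
    -- set.
    i + k , m≤m+n i k , All.lookup (trace-⊑ (m≤n+m k i)) x∈ t

  ◇-Sig-O-O⇒φ-R : ∀ {k} → T (Sig-O-O (valR (σ k))) → σ ⊨ φ-R
  ◇-Sig-O-O⇒φ-R sig i _ _ = inj₁ (inj₁ (◇-latch (here refl) sig i))

  module _ (ttp : σ ⊨ φ-TTP) where

    private
      sig-O = proj₁ (proj₂ ttp)
      sig-R = proj₁ (proj₂ (proj₂ ttp))
      ab-O  = proj₁ (proj₂ (proj₂ (proj₂ ttp)))
      ab-R  = proj₂ (proj₂ (proj₂ (proj₂ ttp)))

    -- An abort token of `R` is excluded from `k` on by the clause of `φ-TTP` for `Sig-O-TTP`, and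
    -- before `k` by the clause for `AB-R`, which would forbid the signature at `k`.
    resolved⇒φ-R : ∀ {k} → T (Sig-O-TTP (valR (σ k))) → σ ⊨ φ-R
    resolved⇒φ-R {k} sig i _ _ =
      inj₁ (inj₂ (◇-latch (there (here refl)) sig i , λ j _ ab →
        [ (λ k≤j → proj₂ (proj₂ (sig-O k z≤n sig) j k≤j) ab)
        , (λ j≤k → proj₁ (proj₂ (ab-R j z≤n ab) k j≤k) sig) ]′ (≤-total k j)))

    -- `Sig-R-R` is excluded because `m₄` needs `m₃`; `Sig-R-TTP` is excluded after and before `k`
    -- by the clauses of `φ-TTP` for `AB-R` and `Sig-R-TTP`.
    aborted⇒φ-R : (∀ j → ¬ T (Sig-O-O (valR (σ j)))) →
                  ∀ {k} → T (AB-R (valR (σ k))) → σ ⊨ φ-R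
    aborted⇒φ-R ¬sig {k} ab i _ _ =
      inj₂ (◇-latch (there (there (here refl))) ab i , λ j _ →
        ¬Sig-O-O⇒¬Sig-R-R ¬sig j , λ sig →
        [ (λ k≤j → proj₂ (proj₂ (ab-R k z≤n ab) j k≤j) sig)
        , (λ j≤k → proj₂ (proj₂ (sig-R j z≤n sig) k j≤k) ab) ]′ (≤-total k j))

    -- If `m₃` never arrives, the first clause of `φ-TTP` yields a token or a signature for one
    -- party; an outcome of `O` is carried over to `R` by the clauses for `AB-O` and `Sig-R-TTP`.
    requested⇒φ-R : (∃ λ j → Requested (σ j)) →
                    Dec (∃ λ k → T (Sig-O-O (valR (σ k)))) → σ ⊨ φ-R
    requested⇒φ-R _         (yes (_ , sig)) = ◇-Sig-O-O⇒φ-R sig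
    requested⇒φ-R (j , req) (no ¬sig) with proj₁ ttp j z≤n req
    ... | inj₁ (k , _ , ab) =
          aborted⇒φ-R (λ l s → ¬sig (l , s)) (proj₂ (proj₂ (proj₁ (ab-O k z≤n ab))))
    ... | inj₂ (inj₁ (_ , _ , ab)) = aborted⇒φ-R (λ l s → ¬sig (l , s)) ab
    ... | inj₂ (inj₂ (inj₁ (_ , _ , sig))) = resolved⇒φ-R sig
    ... | inj₂ (inj₂ (inj₂ (k , _ , sig))) =
          resolved⇒φ-R (proj₂ (proj₂ (proj₁ (sig-R k z≤n sig))))

-- Coalitions

corrupt-≼ : ∀ Y {P′} → (∀ p → P′ p ≼ mostGeneral p) → ∀ p → corrupt Y P′ p ≼ mostGeneral p
corrupt-≼ Y refines p v with Y p
... | true  = id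
... | false = refines p v

corrupt-honest : ∀ Y (P′ : System) p → Y p ≡ false → corrupt Y P′ p ≼ P′ p
corrupt-honest Y P′ p eq v with Y p
corrupt-honest Y P′ p refl v | false = id

module _ {P′ : System} (ags : P-AGS P′) where

  open P-AGS ags

  module _ (Y : PartySet) {σ} (σ∈ : σ ∈ ⟦ corrupt Y P′ ⟧)
           (satisfied : ∀ p → T (Y p) → σ ⊨ objective p) where

    general : ∀ p → corrupt Y P′ p ≼ mostGeneral p
    general = corrupt-≼ Y refines

    ⊨φ-TTP : σ ⊨ φ-TTP
    ⊨φ-TTP with Y TTP in eq
    ... | true  = satisfied TTP (subst T (sym eq) tt)
    ... | false = φ-TTP-unconditional (P′ TTP) cond₃ (⟦⟧-mono (λ where
      O   → general O
      R   → general R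
      TTP → corrupt-honest Y P′ TTP eq) σ∈)

    φ-R⇒φ-O : Y O ≡ false → σ ⊨ φ-R → σ ⊨ φ-O
    φ-R⇒φ-O eq r = cond₁ (⟦⟧-mono (λ where
      O   → corrupt-honest Y P′ O eq
      R   → general R
      TTP → general TTP) σ∈) (r , ⊨φ-TTP)

    φ-O⇒φ-R : Y R ≡ false → σ ⊨ φ-O → σ ⊨ φ-R
    φ-O⇒φ-R eq o = cond₂ (⟦⟧-mono (λ where
      O   → general O
      R   → corrupt-honest Y P′ R eq
      TTP → general TTP) σ∈) (o , ⊨φ-TTP)

    -- In the case without a request the TTP, corrupt or not, is first widened to the most general
    -- one and then replaced by `P′ TTP`.
    honest⇒φ-R : Y O ≡ false → Y R ≡ false →
                 Dec (∃ λ j → Requested (σ j)) → Dec (∃ λ k → T (Sig-O-O (valR (σ k)))) →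
                 σ ⊨ φ-R
    honest⇒φ-R _ _ (yes req) dec = requested⇒φ-R (proj₂ (proj₂ σ∈)) ⊨φ-TTP req dec
    honest⇒φ-R O∉ R∉ (no ¬req) _ with Sc , fair , r ← ⟦⟧-mono {𝒬 = P′ O ∥ P′ R ∥ mostGeneral TTP} (λ where
      O   → corrupt-honest Y P′ O O∉
      R   → corrupt-honest Y P′ R R∉
      TTP → general TTP) σ∈ =
      proj₁ (proj₂ (cond₄ (Sc , fair ,
        Run-unrequested (λ _ → id) (refines TTP) (λ j req → ¬req (j , req)) r)))

    -- Whether a request or `m₃` ever arrives is undecidable on an infinite trace. Attack-freedom is
    -- a negation, so excluded middle under a double negation suffices.
    ¬¬objectives : ¬ ¬ (σ ⊨ φ-O × σ ⊨ φ-R)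
    ¬¬objectives k with Y O in eqO | Y R in eqR
    ... | true  | true  = k (satisfied O (subst T (sym eqO) tt) , satisfied R (subst T (sym eqR) tt))
    ... | true  | false = k (o , φ-O⇒φ-R eqR o)
      where o = satisfied O (subst T (sym eqO) tt)
    ... | false | true  = k (φ-R⇒φ-O eqO r , r)
      where r = satisfied R (subst T (sym eqR) tt)
    ... | false | false = ¬¬-excluded-middle λ req → ¬¬-excluded-middle λ sig →
      let r = honest⇒φ-R eqO eqR req sig in k (φ-R⇒φ-O eqO r , r)

theorem5 : (P′ : System) → P-AGS P′ → AttackFree P′
theorem5 P′ ags Y (σ , σ∈ , satisfied , p , _ , violated) =
  ¬¬objectives ags Y σ∈ satisfied λ (o , r) → violated (case p o r)
  where
  case : ∀ p → σ ⊨ φ-O → σ ⊨ φ-R → σ ⊨ objective p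
  case O   o _ = o
  case R   _ r = r
  case TTP _ _ = ⊨φ-TTP ags Y σ∈ satisfied
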